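{- For every $h\in R$, the binary representation of $h$ does not contain $11$ as a contiguous substring.
   Context: Stern's sequence $(a(n))_{n\ge0}$: $a(0)=0$, $a(1)=1$, $a(2n)=a(n)$, $a(2n+1)=a(n)+a(n+1)$; $s(n)=a(n+1)$ for $n\ge0$. $R$ is the set of record-setters of $s$, i.e. indices $v\ge0$ with $s(i)<s(v)$ for all $i<v$. The binary representation of a positive integer has no leading zeros; $0$ is represented by the string $0$. -}

module Defs where

open import Data.Digit using (Bit; 0b; 1b; toDigits)
open import Data.List.Base using (List; []; _∷_; reverse)
open import Data.Nat.Base using (ℕ; zero; suc; _+_; _*_; _<_; _≤_; s≤s; ⌊_/2⌋; ⌈_/2⌉; parity)
open import Data.Nat.Properties using (≤-refl; ≤-trans; ⌊n/2⌋≤n; ⌈n/2⌉≤n; +-identityʳ; +-comm; +-suc; n≡⌊n+n/2⌋; n≡⌈n+n/2⌉)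
open import Data.Parity.Base using (Parity; 0ℙ; 1ℙ)
open import Data.Product.Base using (proj₁)
open import Level using (0ℓ)
open import Relation.Binary.PropositionalEquality using (_≡_; refl; sym; trans; cong; cong₂)
open import Relation.Unary using (Pred)

sternStep : Parity → ℕ → ℕ → ℕ
sternStep 0ℙ x y = x
sternStep 1ℙ x y = x + y

-- The first argument is fuel for structural recursion; any fuel ≥ n
-- suffices at index n (see sternFuel-irrelevant).
sternFuel : ℕ → ℕ → ℕ
sternFuel _       0             = 0
sternFuel _       1             = 1
sternFuel zero    (suc (suc n)) = 0
sternFuel (suc f) (suc (suc n)) =
  sternStep (parity n) (sternFuel f (suc ⌊ n /2⌋)) (sternFuel f (suc ⌈ n /2⌉))

-- Stern's sequence, characterised by a-zero, a-one, a-even, a-odd below.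
a : ℕ → ℕ
a n = sternFuel n n

sternFuel-irrelevant : ∀ f g n → n ≤ f → n ≤ g → sternFuel f n ≡ sternFuel g n
sternFuel-irrelevant _ _ 0 _ _ = refl
sternFuel-irrelevant _ _ 1 _ _ = refl
sternFuel-irrelevant (suc f) (suc g) (suc (suc n)) (s≤s p) (s≤s q) =
  cong₂ (sternStep (parity n))
    (sternFuel-irrelevant f g _ (≤-trans lo p) (≤-trans lo q))
    (sternFuel-irrelevant f g _ (≤-trans hi p) (≤-trans hi q))
  where
  lo : suc ⌊ n /2⌋ ≤ suc n
  lo = s≤s (⌊n/2⌋≤n n)
  hi : suc ⌈ n /2⌉ ≤ suc n
  hi = s≤s (⌈n/2⌉≤n n)

a-unfold : ∀ n → a (2 + n) ≡ sternStep (parity n) (a (1 + ⌊ n /2⌋)) (a (1 + ⌈ n /2⌉))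
a-unfold n = cong₂ (sternStep (parity n))
  (sternFuel-irrelevant _ _ _ (s≤s (⌊n/2⌋≤n n)) ≤-refl)
  (sternFuel-irrelevant _ _ _ (s≤s (⌈n/2⌉≤n n)) ≤-refl)

parity-n+n : ∀ n → parity (n + n) ≡ 0ℙ
parity-n+n zero = refl
parity-n+n (suc n) = trans (cong (λ k → parity (suc k)) (+-suc n n)) (parity-n+n n)

parity-1+n+n : ∀ n → parity (suc (n + n)) ≡ 1ℙ
parity-1+n+n zero = refl
parity-1+n+n (suc n) = trans (cong parity (+-suc n n)) (parity-1+n+n n)

a-zero : a 0 ≡ 0
a-zero = refl

a-one : a 1 ≡ 1
a-one = refl

a-even : ∀ n → a (2 * n) ≡ a n
a-even zero = refl
a-even (suc n) rewrite +-identityʳ n | +-suc n n | a-unfold (n + n)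
  | parity-n+n n | sym (n≡⌊n+n/2⌋ n) = refl

a-odd : ∀ n → a (2 * n + 1) ≡ a n + a (n + 1)
a-odd zero = refl
a-odd (suc n) rewrite +-identityʳ n | +-comm (n + suc n) 1 | +-suc n n
  | a-unfold (suc (n + n)) | parity-1+n+n n | sym (n≡⌊n+n/2⌋ n)
  | sym (n≡⌈n+n/2⌉ n) | +-comm n 1 = refl

s : ℕ → ℕ
s n = a (n + 1)

R : Pred ℕ 0ℓ
R v = ∀ i → i < v → s i < s v

-- Most significant bit first; toDigits is least significant first, with no
-- superfluous zeros and with 0 sent to the single digit 0.
binary : ℕ → List Bit
binary n = reverse (proj₁ (toDigits 2 n))

private
  binary-0 : binary 0 ≡ 0b ∷ []
  binary-0 = refl

  binary-6 : binary 6 ≡ 1b ∷ 1b ∷ 0b ∷ []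
  binary-6 = refl

{-# OPTIONS --safe #-}
-- Let (q , p) = (a x , a (x + 1)) be the state of x. Appending the bit 0 turns it
-- into (q , q + p) and appending 1 into (q + p , p), so both maps are monotone. If h
-- is odd then s h = s ⌊h/2⌋ and h is no record. Otherwise cut h after its last
-- block 11, so that h = x 11 (01)^j 0 or h = x 11 (01)^j 0 0 z, and put
-- u = x (10)^(j+1). In the first case u 0 is smaller than h and s (u 0) ≥ s h. In
-- the second, u 1 0 is smaller than x 11 (01)^j 0 0 and both components of its state
-- are at least as large; by monotonicity this survives appending z.
module Submission where

open import Defs
open import Data.Digit using (Bit; 1b; fromDigits; toDigits)
open import Data.Fin.Patterns using (0F; 1F)
open import Data.List.Base using (List; []; _∷_; _++_; reverse)
open import Data.List.Properties using (reverse-++; reverse-involutive; ++-assoc)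
open import Data.List.Relation.Binary.Infix.Heterogeneous using (Infix; View; MkView; toView)
open import Data.List.Relation.Binary.Pointwise using ([]; _∷_)
open import Data.Nat.Base using (ℕ; suc; _+_; _*_; _≤_; _<_; s≤s)
open import Data.Nat.Properties using (≤-refl; ≤-trans; ≤-reflexive; <⇒≤; <⇒≱; m≤m+n; m≤m*n; +-comm; *-comm; +-mono-≤; *-monoˡ-≤; *-monoˡ-<)
open import Data.Nat.Tactic.RingSolver using (solve-∀)
open import Data.Product.Base using (∃₂; ∃-syntax; _×_; _,_; proj₂)
open import Data.Product.Relation.Binary.Pointwise.NonDependent using (Pointwise)
open import Function.Base using (_∘_)
open import Relation.Binary.PropositionalEquality using (_≡_; refl; sym; trans; cong; cong₂; subst; subst₂)
open import Relation.Nullary using (¬_)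
open import Relation.Unary using (_∈_)

a-double : ∀ n → a (n * 2) ≡ a n
a-double n = trans (cong a (*-comm n 2)) (a-even n)

a-suc-double : ∀ n → a (suc (n * 2)) ≡ a n + a (suc n)
a-suc-double n = trans (cong a (trans (cong suc (*-comm n 2)) (+-comm 1 (2 * n))))
  (trans (a-odd n) (cong (λ k → a n + a k) (+-comm n 1)))

state : ℕ → ℕ × ℕ
state n = a n , a (suc n)

append0 append1 : ℕ × ℕ → ℕ × ℕ
append0 (q , p) = q , q + p
append1 (q , p) = q + p , p

state-append0 : ∀ n → state (n * 2) ≡ append0 (state n)
state-append0 n = cong₂ _,_ (a-double n) (a-suc-double n)

state-append1 : ∀ n → state (suc (n * 2)) ≡ append1 (state n)
state-append1 n = cong₂ _,_ (a-suc-double n) (a-double (suc n))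

state-append10 : ∀ n → state (suc (n * 2) * 2) ≡ append0 (append1 (state n))
state-append10 n = trans (state-append0 (suc (n * 2))) (cong append0 (state-append1 n))

infix 4 _⊑_

_⊑_ : ℕ × ℕ → ℕ × ℕ → Set
_⊑_ = Pointwise _≤_ _≤_

⊑-append0 : ∀ {v w} → v ⊑ w → append0 v ⊑ append0 w
⊑-append0 (l , m) = l , +-mono-≤ l m

⊑-append1 : ∀ {v w} → v ⊑ w → append1 v ⊑ append1 w
⊑-append1 (l , m) = +-mono-≤ l m , m

-- Satisfied by the states of u = x (10)^(j+1) and n = x 11 (01)^j 0.
record Covers (u n : ℕ × ℕ) : Set where
  constructor covers
  field
    p≤   : proj₂ n ≤ proj₂ (append0 u)
    both : append0 n ⊑ append0 (append1 u)

-- The case j = 0; each summand given to `m≤m+n` is the exact gap between the two sides.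
covers-append110 : ∀ v → Covers (append0 (append1 v)) (append0 (append1 (append1 v)))
covers-append110 (q , p) = covers
  (≤-trans (m≤m+n _ q) (≤-reflexive (eq₁ q p)))
  ( ≤-trans (m≤m+n _ (p + q)) (≤-reflexive (eq₂ q p))
  , ≤-trans (m≤m+n _ q) (≤-reflexive (eq₃ q p)))
  where
  eq₁ : ∀ q p → q + p + p + p + q ≡ q + p + (q + p + p)
  eq₁ = solve-∀
  eq₂ : ∀ q p → q + p + p + (p + q) ≡ q + p + (q + p + p)
  eq₂ = solve-∀
  eq₃ : ∀ q p → q + p + p + (q + p + p + p) + q ≡ q + p + (q + p + p) + (q + p + p)
  eq₃ = solve-∀

-- Adding `p≤` and `q+p≤` gives `p≤′`, and adding `q+p≤` once more bounds the last component.
covers-append10 : ∀ {u n} → Covers u n → Covers (append0 (append1 u)) (append0 (append1 n))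
covers-append10 {t , r} {q , p} (covers p≤ (_ , q+p≤)) = covers p≤′
  ( ≤-trans (m≤m+n (q + p) p) p≤′
  , subst (_≤ t + r + (t + r + r) + (t + r + r)) (+-comm (q + p + p) (q + p))
      (+-mono-≤ p≤′ q+p≤))
  where
  p≤′ : q + p + p ≤ t + r + (t + r + r)
  p≤′ = subst (q + p + p ≤_) (+-comm (t + r + r) (t + r)) (+-mono-≤ q+p≤ p≤)

-- The bound `below` serves both endings: it puts u0 below n and, after doubling, u10 below n0.
record Fork (u n : ℕ) : Set where
  constructor fork
  field
    below : suc (u * 2) < n
    cover : Covers (state u) (state n)

fork-append110 : ∀ x → Fork (suc (x * 2) * 2) (suc (suc (x * 2) * 2) * 2)
-- x110 is the successor of x101.
fork-append110 x = fork ≤-refl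
  (subst₂ Covers (sym (state-append10 x))
    (sym (trans (state-append10 (suc (x * 2))) (cong (append0 ∘ append1) (state-append1 x))))
    (covers-append110 (state x)))

fork-append10 : ∀ {u n} → Fork u n → Fork (suc (u * 2) * 2) (suc (n * 2) * 2)
fork-append10 {u} {n} (fork below cover) = fork
  -- The successor of u101 is u110, so u1 and n are compared with 10 appended to each.
  (*-monoˡ-≤ 2 (s≤s (*-monoˡ-≤ 2 (<⇒≤ below))))
  (subst₂ Covers (sym (state-append10 u)) (sym (state-append10 n)) (covers-append10 cover))

fork-append0 : ∀ {u n} → Fork u n → state (n * 2) ⊑ state (suc (u * 2) * 2)
fork-append0 {u} {n} (fork _ cover) =
  subst₂ _⊑_ (sym (state-append0 n)) (sym (state-append10 u)) (Covers.both cover)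

-- What is needed about a number containing 11, according to what follows its last
-- 11: nothing, (01)^j with j ≥ 1, (01)^j 0, or (01)^j 0 0 z.
data Has11 : ℕ → Set where
  ends11    : ∀ x → Has11 (suc (suc (x * 2) * 2))
  ends01    : ∀ {u n} → Fork u n → Has11 (suc (n * 2))
  ends0     : ∀ {u n} → Fork u n → Has11 n
  dominated : ∀ {m n} → m < n → state n ⊑ state m → Has11 n

has11-append0 : ∀ {n} → Has11 n → Has11 (n * 2)
has11-append0 (ends11 x) = ends0 (fork-append110 x)
has11-append0 (ends01 f) = ends0 (fork-append10 f)
has11-append0 (ends0 f)  = dominated (*-monoˡ-< 2 (Fork.below f)) (fork-append0 f)
has11-append0 (dominated {m} {n} l d) = dominated (*-monoˡ-< 2 l)
  (subst₂ _⊑_ (sym (state-append0 n)) (sym (state-append0 m)) (⊑-append0 d))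

has11-append1 : ∀ {n} → Has11 n → Has11 (suc (n * 2))
-- A 1 after a final 1 makes a new last 11, so the analysis restarts there.
has11-append1 (ends11 x)         = ends11 (suc (x * 2))
has11-append1 (ends01 {n = n} f) = ends11 n
has11-append1 (ends0 f)          = ends01 f
has11-append1 (dominated {m} {n} l d) = dominated (s≤s (*-monoˡ-< 2 l))
  (subst₂ _⊑_ (sym (state-append1 n)) (sym (state-append1 m)) (⊑-append1 d))

-- Digits are least significant first, so `ys` holds the bits after the chosen 11, which need not be
-- the last one.
has11-fromDigits : ∀ (ys xs : List Bit) → Has11 (fromDigits (ys ++ 1b ∷ 1b ∷ xs))
has11-fromDigits []        xs = ends11 (fromDigits xs)
has11-fromDigits (0F ∷ ys) xs = has11-append0 (has11-fromDigits ys xs)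
has11-fromDigits (1F ∷ ys) xs = has11-append1 (has11-fromDigits ys xs)

-- Dropping the final 1 leaves the value of `s` unchanged, and a tie already refutes a strict
-- record.
odd-beaten : ∀ n → ∃[ m ] m < suc (n * 2) × a (suc (suc (n * 2))) ≤ a (suc m)
odd-beaten n = n , s≤s (m≤m*n n 2) , ≤-reflexive (a-double (suc n))

has11-beaten : ∀ {n} → Has11 n → ∃[ m ] m < n × a (suc n) ≤ a (suc m)
has11-beaten (ends11 x)            = odd-beaten (suc (x * 2))
has11-beaten (ends01 {n = n} f)    = odd-beaten n
has11-beaten (ends0 {u} (fork l c)) =
  -- `a (suc (u * 2))` is the second component of `append0 (state u)`.
  u * 2 , <⇒≤ l , subst (_ ≤_) (sym (a-suc-double u)) (Covers.p≤ c)
has11-beaten (dominated l (_ , d)) = _ , l , d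

has11⇒∉R : ∀ {n} → Has11 n → ¬ n ∈ R
has11⇒∉R {n} h n∈R with m , m<n , le ← has11-beaten h =
  <⇒≱ (n∈R m m<n) (subst (λ k → a k ≤ s m) (+-comm 1 n)
    (subst (λ k → a (suc n) ≤ a k) (+-comm 1 m) le))

infix-reverse : ∀ {A : Set} {x y : A} (ds : List A) → Infix _≡_ (x ∷ y ∷ []) (reverse ds) →
  ∃₂ λ ys xs → ds ≡ ys ++ y ∷ x ∷ xs
infix-reverse {x = x} {y} ds inf = go refl (toView inf)
  where
  -- Generalising `reverse ds` to `es` lets the view be matched.
  go : ∀ {es} → reverse ds ≡ es → View _≡_ (x ∷ y ∷ []) es → ∃₂ λ ys xs → ds ≡ ys ++ y ∷ x ∷ xs
  go eq (MkView pref (refl ∷ refl ∷ []) suff) = reverse suff , reverse pref ,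
    trans (sym (reverse-involutive ds)) (trans (cong reverse eq)
      (trans (reverse-++ pref (x ∷ y ∷ suff))
        (trans (cong (_++ reverse pref) (reverse-++ (x ∷ y ∷ []) suff))
          (++-assoc (reverse suff) (y ∷ x ∷ []) (reverse pref)))))

mainTheorem6 : ∀ (h : ℕ) → h ∈ R → ¬ Infix _≡_ (1b ∷ 1b ∷ []) (binary h)
mainTheorem6 h h∈R inf with ds , eq ← toDigits 2 h with ys , xs , split ← infix-reverse ds inf =
  has11⇒∉R (subst Has11 (trans (cong fromDigits (sym split)) eq) (has11-fromDigits ys xs)) h∈R
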